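{- For all integers $k\geq 5$ and $n\geq 2$, $$Q(n,k)\leq 2^{c_k(k-2)^n},\qquad\text{where } c_k=\frac{\log_2 k!}{k-2}+\frac{k}{k-4}.$$
   Context: An $n$-ary quasigroup of order $k$ is a function $f:\Sigma^n\to\Sigma$, where $\Sigma=\{0,1,\dots,k-1\}$, such that fixing any $n-1$ of its arguments to arbitrary values of $\Sigma$ yields a bijection $\Sigma\to\Sigma$ in the remaining argument. $Q(n,k)$ denotes the number of distinct $n$-ary quasigroups of order $k$ on the fixed set $\Sigma=\{0,1,\dots,k-1\}$. -}

module Defs where

open import Data.Fin using (Fin; finToFun; funToFin)
import Data.Fin.Properties as Fin
open import Data.Integer using (ℤ; +_; -[1+_]; ∣_∣)
import Data.Integer as ℤ
import Data.Integer.Properties as ℤ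
open import Data.List using (length; filter; allFin)
open import Data.Nat using (ℕ; zero; suc; _∸_; _!; s≤s; z≤n)
import Data.Nat as ℕ
import Data.Nat.Properties as ℕ
open import Data.Product using (∃; ∃₂; _×_; _,_; proj₁; proj₂)
open import Data.Rational.Unnormalised using (ℚᵘ; mkℚᵘ; _/_; 0ℚᵘ; 1ℚᵘ; ½; ↥_; ↧ₙ_; *≤*; *<*)
import Data.Rational.Unnormalised as ℚ
import Data.Rational.Unnormalised.Properties as ℚ
open import Data.Vec using (Vec; []; _∷_; lookup; tabulate; _[_]≔_)
open import Data.Vec.Properties using (lookup∘tabulate; tabulate∘lookup; tabulate-cong)
open import Function using (_∘_)
open import Function.Definitions using (Bijective)
open import Relation.Binary.PropositionalEquality using (_≡_; _≗_; refl; sym; trans; cong; subst)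
open import Relation.Nullary using (¬_; Dec; yes; no; contradiction)
open import Relation.Nullary.Decidable using (map′; _×-dec_; _→-dec_)

------------------------------------------------------------------------
-- n-ary quasigroups of order k, with Σ = Fin k and Σⁿ = Vec (Fin k) n

-- The value of x at position i is irrelevant: x only supplies the n - 1
-- fixed arguments.
IsQuasigroup : ∀ {n k} → (Vec (Fin k) n → Fin k) → Set
IsQuasigroup f = ∀ i x → Bijective _≡_ _≡_ (λ a → f (x [ i ]≔ a))

bijective? : ∀ {k} (g : Fin k → Fin k) → Dec (Bijective _≡_ _≡_ g)
bijective? g =
  map′ (λ inj {x} {y} → inj x y) (λ inj x y → inj)
       (Fin.all? λ x → Fin.all? λ y → (g x Fin.≟ g y) →-dec (x Fin.≟ y))
  ×-dec
  Fin.all? (λ y → map′ (λ (x , gx≡y) → x , λ { refl → gx≡y })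
                       (λ (x , h) → x , h refl)
                       (Fin.any? λ x → g x Fin.≟ y))

allVec? : ∀ {n k} {P : Vec (Fin k) n → Set} → (∀ x → Dec (P x)) → Dec (∀ x → P x)
allVec? {zero}  P? = map′ (λ { p [] → p }) (λ p → p []) (P? [])
allVec? {suc n} P? = map′ (λ { p (a ∷ x) → p a x }) (λ p a x → p (a ∷ x))
                          (Fin.all? λ a → allVec? λ x → P? (a ∷ x))

isQuasigroup? : ∀ {n k} (f : Vec (Fin k) n → Fin k) → Dec (IsQuasigroup f)
isQuasigroup? f = Fin.all? λ i → allVec? λ x → bijective? (λ a → f (x [ i ]≔ a))

-- Numbering of all k ^ (k ^ n) functions Σⁿ → Σ; every function occurs
-- exactly once up to pointwise equality (decode-injective and
-- decode-surjective).
decode : ∀ {n k} → Fin (k ℕ.^ (k ℕ.^ n)) → Vec (Fin k) n → Fin k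
decode j x = finToFun j (funToFin (lookup x))

private
  funToFin-cong : ∀ {m n} {f g : Fin m → Fin n} → f ≗ g → funToFin f ≡ funToFin g
  funToFin-cong {zero}  f≗g = refl
  funToFin-cong {suc m} f≗g
    rewrite f≗g Fin.zero | funToFin-cong (f≗g ∘ Fin.suc) = refl

decode-injective : ∀ {n k} (i j : Fin (k ℕ.^ (k ℕ.^ n))) →
                   decode {n} {k} i ≗ decode {n} {k} j → i ≡ j
decode-injective {n} {k} i j eq =
  trans (sym (Fin.funToFin-finToFin {k ℕ.^ n} {k} i))
    (trans (funToFin-cong pointwise) (Fin.funToFin-finToFin {k ℕ.^ n} {k} j))
  where
  point : Fin (k ℕ.^ n) → Vec (Fin k) n
  point t = tabulate (finToFun {k} {n} t)
  encode-point : ∀ t → funToFin (lookup (point t)) ≡ t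
  encode-point t = trans (funToFin-cong (lookup∘tabulate (finToFun {k} {n} t)))
                         (Fin.funToFin-finToFin {n} {k} t)
  pointwise : finToFun {k} {k ℕ.^ n} i ≗ finToFun {k} {k ℕ.^ n} j
  pointwise t = subst (λ u → finToFun {k} {k ℕ.^ n} i u ≡ finToFun {k} {k ℕ.^ n} j u)
                      (encode-point t) (eq (point t))

decode-surjective : ∀ {n k} (f : Vec (Fin k) n → Fin k) → ∃ λ j → decode {n} {k} j ≗ f
decode-surjective {n} {k} f = funToFin g , λ x →
  trans (Fin.finToFun-funToFin g (funToFin (lookup x)))
        (cong f (trans (tabulate-cong (Fin.finToFun-funToFin (lookup x))) (tabulate∘lookup x)))
  where
  g : Fin (k ℕ.^ n) → Fin k
  g t = f (tabulate (finToFun {k} {n} t))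

Q : ℕ → ℕ → ℕ
Q n k = length (filter (λ j → isQuasigroup? (decode {n} {k} j)) (allFin (k ℕ.^ (k ℕ.^ n))))

------------------------------------------------------------------------
-- Real numbers, as the upper halves of Dedekind cuts: x <ℚ r says x < r

record ℝ : Set₁ where
  field
    _<ℚ_      : ℚᵘ → Set
    inhabited : ∃ _<ℚ_
    bounded   : ∃ λ r → ¬ _<ℚ_ r
    upward    : ∀ {r s} → r ℚ.≤ s → _<ℚ_ r → _<ℚ_ s
    open-cut  : ∀ {s} → _<ℚ_ s → ∃ λ r → r ℚ.< s × _<ℚ_ r

open ℝ public

infix 4 _≤_
_≤_ : ℝ → ℝ → Set
x ≤ y = ∀ r → (y <ℚ r) → (x <ℚ r)

-- The infimum of an inhabited set of rationals that is bounded below.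
inf : (G : ℚᵘ → Set) → ∃ G → (∃ λ l → ∀ g → G g → l ℚ.≤ g) → ℝ
inf G (g₀ , Gg₀) (l , l≤G) = record
  { _<ℚ_      = λ r → ∃ λ g → G g × g ℚ.< r
  ; inhabited = g₀ ℚ.+ 1ℚᵘ , g₀ , Gg₀ , g<g+1 g₀
  ; bounded   = l , λ (g , Gg , g<l) → ℚ.<⇒≱ g<l (l≤G g Gg)
  ; upward    = λ r≤s (g , Gg , g<r) → g , Gg , ℚ.<-≤-trans g<r r≤s
  ; open-cut  = λ (g , Gg , g<s) → let (r , g<r , r<s) = ℚ.<-dense g<s
                                   in r , r<s , g , Gg , g<r
  }
  where
  g<g+1 : ∀ g → g ℚ.< g ℚ.+ 1ℚᵘ
  g<g+1 g = ℚ.<-respˡ-≃ (ℚ.+-identityʳ g) (ℚ.+-monoʳ-< g (ℚ.positive⁻¹ 1ℚᵘ))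

lower : (x : ℝ) → ∃ λ l → ∀ g → (x <ℚ g) → l ℚ.≤ g
lower x = l , λ g x<g → ℚ.≮⇒≥ λ g<l → x≮l (upward x (ℚ.<⇒≤ g<l) x<g)
  where
  l = proj₁ (bounded x)
  x≮l = proj₂ (bounded x)

ratℕ : ℕ → ℚᵘ
ratℕ m = + m / 1

fromℕ : ℕ → ℝ
fromℕ m = inf (_≡ ratℕ m) (ratℕ m , refl) (ratℕ m , λ { _ refl → ℚ.≤-refl })

infixl 6 _+_
_+_ : ℝ → ℝ → ℝ
x + y = inf (λ r → ∃₂ λ s t → (x <ℚ s) × (y <ℚ t) × r ≡ s ℚ.+ t)
  (let (s , x<s) = inhabited x ; (t , y<t) = inhabited y in s ℚ.+ t , s , t , x<s , y<t , refl)
  (let (l , l≤) = lower x ; (m , m≤) = lower y in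
   l ℚ.+ m , λ { _ (s , t , x<s , y<t , refl) → ℚ.+-mono-≤ (l≤ s x<s) (m≤ t y<t) })

scale : (q : ℚᵘ) → ℚ.NonNegative q → ℝ → ℝ
scale q q≥0 x = inf (λ r → ∃ λ s → (x <ℚ s) × r ≡ s ℚ.* q)
  (let (s , x<s) = inhabited x in s ℚ.* q , s , x<s , refl)
  (let (l , l≤) = lower x in
   l ℚ.* q , λ { _ (s , x<s , refl) → ℚ.*-monoˡ-≤-nonNeg q {{q≥0}} (l≤ s x<s) })

infixl 7 _*_ _÷_
_*_ : ℝ → ℕ → ℝ
x * m = scale (ratℕ m) _ x

_÷_ : ℝ → (d : ℕ) → .{{ℕ.NonZero d}} → ℝ
x ÷ d@(suc _) = scale (+ 1 / d) _ x

infixr 8 _^_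
_^_ : ℚᵘ → ℕ → ℚᵘ
q ^ zero  = 1ℚᵘ
q ^ suc n = q ℚ.* q ^ n

2^ℤ : ℤ → ℚᵘ
2^ℤ (+ n)    = ratℕ 2 ^ n
2^ℤ -[1+ n ] = ½ ^ suc n

private
  ratℕ-mono : ∀ {a b} → a ℕ.≤ b → ratℕ a ℚ.≤ ratℕ b
  ratℕ-mono a≤b = *≤* (ℤ.*-monoʳ-≤-nonNeg (+ 1) (ℤ.+≤+ a≤b))

  ratℕ-^ : ∀ m n → ratℕ m ^ n ≡ ratℕ (m ℕ.^ n)
  ratℕ-^ m zero    = refl
  ratℕ-^ m (suc n) rewrite ratℕ-^ m n = cong (_/ 1) (sym (ℤ.pos-* m (m ℕ.^ n)))

  n≤2^n : ∀ n → n ℕ.≤ 2 ℕ.^ n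
  n≤2^n zero    = z≤n
  n≤2^n (suc n) = ℕ.+-mono-≤ (ℕ.m^n>0 2 n) (ℕ.≤-trans (n≤2^n n) (ℕ.m≤m+n _ 0))

  ½^n≤1 : ∀ n → ½ ^ n ℚ.≤ 1ℚᵘ
  ½^n≤1 zero    = ℚ.≤-refl
  ½^n≤1 (suc n) = ℚ.≤-trans (ℚ.*-monoʳ-≤-nonNeg ½ (½^n≤1 n)) (*≤* (ℤ.+≤+ (s≤s z≤n)))

  ½^1+n<1 : ∀ n → ½ ^ suc n ℚ.< 1ℚᵘ
  ½^1+n<1 n = ℚ.≤-<-trans (ℚ.*-monoʳ-≤-nonNeg ½ (½^n≤1 n)) (*<* (ℤ.+<+ (s≤s (s≤s z≤n))))

-- m ≤ 2^(p/q), i.e. m^q ≤ 2^p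
_≤2^_ : ℕ → ℚᵘ → Set
m ≤2^ s = ratℕ m ^ ↧ₙ s ℚ.≤ 2^ℤ (↥ s)

-- 2^(p/q) ≤ r, i.e. r is positive and 2^p ≤ r^q
2^_≤ℚ_ : ℚᵘ → ℚᵘ → Set
2^ s ≤ℚ r = ℚ.Positive r × 2^ℤ (↥ s) ℚ.≤ r ^ ↧ₙ s

log₂ : (m : ℕ) → .{{ℕ.NonZero m}} → ℝ
log₂ m = inf (m ≤2^_) (ratℕ m , m≤2^m) (0ℚᵘ , nonneg)
  where
  m≤2^m : m ≤2^ ratℕ m
  m≤2^m rewrite ratℕ-^ m 1 | ratℕ-^ 2 m | ℕ.*-identityʳ m = ratℕ-mono (n≤2^n m)
  nonneg : ∀ s → m ≤2^ s → 0ℚᵘ ℚ.≤ s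
  nonneg (mkℚᵘ (+ p)    d) _ = ℚ.nonNegative⁻¹ (mkℚᵘ (+ p) d)
  nonneg (mkℚᵘ -[1+ p ] d) h rewrite ratℕ-^ m (suc d) =
    contradiction (ℚ.≤-trans (ratℕ-mono (ℕ.m^n>0 m (suc d))) h) (ℚ.<⇒≱ (½^1+n<1 p))

infix 8 2^_
2^_ : ℝ → ℝ
2^ x = inf (λ r → ∃ λ s → (x <ℚ s) × 2^ s ≤ℚ r)
  (let (s , x<s) = inhabited x in above s , s , x<s , 2^s≤above s)
  (0ℚᵘ , λ r (_ , _ , r>0 , _) → ℚ.<⇒≤ (ℚ.positive⁻¹ r {{r>0}}))
  where
  above : ℚᵘ → ℚᵘ
  above s = ratℕ (2 ℕ.^ ∣ ↥ s ∣)
  2^s≤above : ∀ s → 2^ s ≤ℚ above s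
  2^s≤above s@(mkℚᵘ p d) = ℚ.positive (ℚ.<-≤-trans (ℚ.positive⁻¹ 1ℚᵘ) (ratℕ-mono 1≤a)) , bound p
    where
    1≤a : 1 ℕ.≤ 2 ℕ.^ ∣ p ∣
    1≤a = ℕ.m^n>0 2 ∣ p ∣
    bound : ∀ p → 2^ℤ p ℚ.≤ ratℕ (2 ℕ.^ ∣ p ∣) ^ suc d
    bound p rewrite ratℕ-^ (2 ℕ.^ ∣ p ∣) (suc d) = bound′ p
      where
      bound′ : ∀ p → 2^ℤ p ℚ.≤ ratℕ ((2 ℕ.^ ∣ p ∣) ℕ.^ suc d)
      bound′ (+ n) rewrite ratℕ-^ 2 n =
        ratℕ-mono (ℕ.m≤m*n _ _ {{ℕ.m^n≢0 (2 ℕ.^ n) d {{ℕ.m^n≢0 2 n}}}})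
      bound′ -[1+ n ] = ℚ.≤-trans (½^n≤1 (suc n))
        (ratℕ-mono (ℕ.m^n>0 (2 ℕ.^ suc n) {{ℕ.m^n≢0 2 (suc n)}} (suc d)))

c : (k : ℕ) → 5 ℕ.≤ k → ℝ
c k 5≤k = log₂ (k !) ÷ (k ∸ 2) + fromℕ k ÷ (k ∸ 4)
  where
  instance
    k!≢0 : ℕ.NonZero (k !)
    k!≢0 = k ℕ.!≢0
    k∸2≢0 : ℕ.NonZero (k ∸ 2)
    k∸2≢0 = ℕ.>-nonZero (ℕ.m<n⇒0<n∸m (ℕ.≤-trans (s≤s (s≤s (s≤s z≤n))) 5≤k))
    k∸4≢0 : ℕ.NonZero (k ∸ 4)
    k∸4≢0 = ℕ.>-nonZero (ℕ.m<n⇒0<n∸m 5≤k)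

{-# OPTIONS --safe #-}
module Submission where

-- An (n+1)-ary quasigroup of order k is a k-tuple of n-ary ones, its layers.  Fix all layers but
-- two.  Then each column has two values left, and the quasigroup is a choice, at every point x
-- of Σⁿ, of the one that goes to the layer 0.  Split a set S of such quasigroups according to the
-- choice at a point x on which S is not unanimous.  Each of the two parts becomes unanimous at x
-- and, on every line through a point that it newly settles, at a second one: the symbol settled
-- here is excluded where another member of S puts it.  A nonempty set of points that meets
-- each line in no or at least two points has at least 2ⁿ points, so S can be split to singletons
-- in kⁿ / 2ⁿ rounds.  Hence Q(n+1,k) ≤ Q(n,k)^(k-2) · 2^((k/2)ⁿ).  Iterating from Q(1,k) ≤ k!
-- gives log₂ Q(n,k) ≤ (k-2)^(n-1) (log₂ k! + k/(k-4)), by summing a geometric series.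

module Counting where

  open import Data.Nat
  open import Algebra.Definitions.RawMonoid +-0-rawMonoid using (sum)
  open import Data.Bool using (if_then_else_)
  open import Data.Fin using (Fin; zero; suc; combine; punchOut; funToFin; finToFun)
  import Data.Fin.Properties as Fin
  open import Data.List using (List; []; _∷_; length; filter; map; allFin)
  import Data.List as List
  open import Data.List.Membership.Propositional using (_∈_; find)
  open import Data.List.Membership.Propositional.Properties using (∈-filter⁺; ∈-filter⁻; ∈-allFin)
  open import Data.List.Properties using (length-map)
  open import Data.List.Relation.Unary.All as All using (All; []; _∷_)
  open import Data.List.Relation.Unary.All.Properties using (¬All⇒Any¬; all-filter)
  open import Data.List.Relation.Unary.AllPairs as AllPairs using (AllPairs; []; _∷_)
  import Data.List.Relation.Unary.AllPairs.Properties as AllPairs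
  open import Data.List.Relation.Unary.Any using (here; there; index)
  open import Data.List.Relation.Unary.Any.Properties using (lookup-index)
  import Data.List.Relation.Unary.Unique.Propositional.Properties as Unique
  open import Data.Nat.Induction using (<-wellFounded)
  open import Data.Nat.Properties
  open import Data.Nat.Tactic.RingSolver using (solve-∀)
  open import Data.Product using (∃; _×_; _,_; proj₁; proj₂)
  open import Data.Sum using (_⊎_; inj₁; inj₂)
  open import Data.Vec using (Vec; []; _∷_; lookup; _[_]≔_)
  open import Data.Vec.Properties using ([]≔-lookup)
  open import Defs using (IsQuasigroup; isQuasigroup?; allVec?; decode; decode-injective; decode-surjective; Q)
  open import Function using (_∘_)
  open import Function.Definitions using (Injective)
  open import Induction.WellFounded using (Acc; acc)
  open import Relation.Binary.PropositionalEquality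
  open import Relation.Nullary using (¬_; Dec; yes; no; contradiction; does; ¬?)

  -- Finite sums and sums over the cube.

  sum-mono : ∀ {n} {f g : Fin n → ℕ} → (∀ i → f i ≤ g i) → sum f ≤ sum g
  sum-mono {zero}  f≤g = z≤n
  sum-mono {suc n} f≤g = +-mono-≤ (f≤g zero) (sum-mono (f≤g ∘ suc))

  sum-bound : ∀ {n} {f : Fin n → ℕ} {B} → (∀ i → f i ≤ B) → sum f ≤ n * B
  sum-bound {zero}  f≤B = z≤n
  sum-bound {suc n} f≤B = +-mono-≤ (f≤B zero) (sum-bound (f≤B ∘ suc))

  sum-gain : ∀ {n} {f g : Fin n → ℕ} {d} → (∀ i → f i ≤ g i) →
             ∀ a → f a + d ≤ g a → sum f + d ≤ sum g
  sum-gain {f = f} {g} {d} f≤g zero fa = begin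
    f zero + sum (f ∘ suc) + d   ≡⟨ +-assoc (f zero) _ d ⟩
    f zero + (sum (f ∘ suc) + d) ≡⟨ cong (f zero +_) (+-comm _ d) ⟩
    f zero + (d + sum (f ∘ suc)) ≡⟨ +-assoc (f zero) d _ ⟨
    f zero + d + sum (f ∘ suc)   ≤⟨ +-mono-≤ fa (sum-mono (f≤g ∘ suc)) ⟩
    sum g                        ∎
    where open ≤-Reasoning
  sum-gain {f = f} {g} {d} f≤g (suc a) fa = begin
    f zero + sum (f ∘ suc) + d   ≡⟨ +-assoc (f zero) _ d ⟩
    f zero + (sum (f ∘ suc) + d) ≤⟨ +-mono-≤ (f≤g zero) (sum-gain (f≤g ∘ suc) a fa) ⟩
    sum g                        ∎
    where open ≤-Reasoning

  -- Two gains at different indices add up. This is the doubling per dimension behind `2 ^ m` in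
  -- `cubeSum-gain`.
  sum-gain₂ : ∀ {n} {f g : Fin n → ℕ} {d} → (∀ i → f i ≤ g i) →
              ∀ a b → a ≢ b → f a + d ≤ g a → f b + d ≤ g b → sum f + 2 * d ≤ sum g
  sum-gain₂ f≤g zero zero a≢b fa fb = contradiction refl a≢b
  sum-gain₂ {f = f} {g} {d} f≤g zero (suc b) a≢b fa fb = begin
    f zero + sum (f ∘ suc) + 2 * d     ≡⟨ regroup (f zero) _ d ⟩
    f zero + d + (sum (f ∘ suc) + d)   ≤⟨ +-mono-≤ fa (sum-gain (f≤g ∘ suc) b fb) ⟩
    sum g                              ∎
    where
    open ≤-Reasoning
    regroup : ∀ p q d → p + q + 2 * d ≡ p + d + (q + d)
    regroup = solve-∀
  sum-gain₂ f≤g (suc a) zero a≢b fa fb = sum-gain₂ f≤g zero (suc a) (a≢b ∘ sym) fb fa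
  sum-gain₂ {f = f} {g} {d} f≤g (suc a) (suc b) a≢b fa fb = begin
    f zero + sum (f ∘ suc) + 2 * d   ≡⟨ +-assoc (f zero) _ (2 * d) ⟩
    f zero + (sum (f ∘ suc) + 2 * d) ≤⟨ +-mono-≤ (f≤g zero) (sum-gain₂ (f≤g ∘ suc) a b (a≢b ∘ cong suc) fa fb) ⟩
    sum g                            ∎
    where open ≤-Reasoning

  cubeSum : ∀ {k} m → (Vec (Fin k) m → ℕ) → ℕ
  cubeSum zero    u = u []
  cubeSum (suc m) u = sum λ a → cubeSum m λ x → u (a ∷ x)

  cubeSum-mono : ∀ {k} m {v u : Vec (Fin k) m → ℕ} → (∀ x → v x ≤ u x) → cubeSum m v ≤ cubeSum m u
  cubeSum-mono zero    v≤u = v≤u []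
  cubeSum-mono (suc m) v≤u = sum-mono λ a → cubeSum-mono m λ x → v≤u (a ∷ x)

  cubeSum-bound : ∀ {k} m {u : Vec (Fin k) m → ℕ} → (∀ x → u x ≤ 1) → cubeSum m u ≤ k ^ m
  cubeSum-bound zero    u≤1 = u≤1 []
  cubeSum-bound (suc m) u≤1 = sum-bound λ a → cubeSum-bound m λ x → u≤1 (a ∷ x)

  -- The points with `v x < u x` form a nonempty set that meets each line in no or at least two
  -- points, so there are at least `2 ^ m` of them. By induction on the dimension: the line in
  -- direction 0 through such a point contains a second one, and the two parallel slices through
  -- these points each inherit the closure property, so each gains `2 ^ (m - 1)`.
  cubeSum-gain : ∀ {k} m {v u : Vec (Fin k) m → ℕ} → (∀ x → v x ≤ u x) →
    (∀ x → v x < u x → ∀ i → ∃ λ b → b ≢ lookup x i × v (x [ i ]≔ b) < u (x [ i ]≔ b)) →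
    ∀ x → v x < u x → cubeSum m v + 2 ^ m ≤ cubeSum m u
  cubeSum-gain zero {v} v≤u closed [] v<u rewrite +-comm (v []) 1 = v<u
  cubeSum-gain (suc m) v≤u closed (a ∷ x) v<u with closed (a ∷ x) v<u zero
  ... | b , b≢a , v<u′ = sum-gain₂ (λ i → cubeSum-mono m λ y → v≤u (i ∷ y)) b a b≢a (slice b v<u′) (slice a v<u)
    where
    slice = λ i → cubeSum-gain m (λ y → v≤u (i ∷ y)) (λ y v<u j → closed (i ∷ y) v<u (suc j)) x

  ¬∀⟶∃¬ᵛ : ∀ {k} n {P : Vec (Fin k) n → Set} → (∀ x → Dec (P x)) → ¬ (∀ x → P x) → ∃ λ x → ¬ P x
  ¬∀⟶∃¬ᵛ zero    P? ¬∀ = [] , λ p → ¬∀ λ { [] → p }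
  ¬∀⟶∃¬ᵛ {k} (suc n) P? ¬∀ with Fin.¬∀⟶∃¬ k _ (λ a → allVec? λ x → P? (a ∷ x)) (λ h → ¬∀ λ { (a ∷ x) → h a x })
  ... | a , ¬∀a with ¬∀⟶∃¬ᵛ n (λ x → P? (a ∷ x)) ¬∀a
  ...   | x , ¬p = a ∷ x , ¬p

  -- Splitting lists and counting by fibres.

  length-split : ∀ {A : Set} {P : A → Set} (P? : ∀ x → Dec (P x)) xs →
                 length xs ≡ length (filter P? xs) + length (filter (¬? ∘ P?) xs)
  length-split P? [] = refl
  length-split P? (x ∷ xs) with P? x
  ... | yes _ = cong suc (length-split P? xs)
  ... | no  _ = trans (cong suc (length-split P? xs)) (sym (+-suc _ _))

  -- The bound is a maximum, hence one of the values or 0, and so inherits `P`. With `P B` of the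
  -- form `B ^ d ≤ E` this gives a common bound on the values without extracting a `d`-th root of
  -- `E`.
  uniform-bound : ∀ {K} (l : Fin K → ℕ) (P : ℕ → Set) → P 0 → (∀ i → P (l i)) →
                  ∃ λ B → P B × (∀ i → l i ≤ B)
  uniform-bound {zero}  l P P0 Pl = 0 , P0 , λ ()
  uniform-bound {suc K} l P P0 Pl with uniform-bound (l ∘ suc) P P0 (Pl ∘ suc)
  ... | B , PB , l≤B with ≤-total (l zero) B
  ...   | inj₁ l₀≤B = B , PB , λ { zero → l₀≤B ; (suc i) → l≤B i }
  ...   | inj₂ B≤l₀ = l zero , Pl zero , λ { zero → ≤-refl ; (suc i) → ≤-trans (l≤B i) B≤l₀ }

  module _ {A : Set} {K} (key : A → Fin K) where

    fibre : List A → Fin K → List A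
    fibre xs c = filter (λ x → key x Fin.≟ c) xs

    length≤sum-fibres : ∀ xs → length xs ≤ sum (length ∘ fibre xs)
    length≤sum-fibres []       = z≤n
    length≤sum-fibres (x ∷ xs) = begin
      suc (length xs)                   ≡⟨ +-comm 1 (length xs) ⟩
      length xs + 1                     ≤⟨ +-monoˡ-≤ 1 (length≤sum-fibres xs) ⟩
      sum (length ∘ fibre xs) + 1        ≤⟨ sum-gain grow (key x) grow-at ⟩
      sum (length ∘ fibre (x ∷ xs))      ∎
      where
      open ≤-Reasoning
      grow : ∀ c → length (fibre xs c) ≤ length (fibre (x ∷ xs) c)
      grow c with key x Fin.≟ c
      ... | yes _ = n≤1+n _
      ... | no  _ = ≤-refl
      grow-at : length (fibre xs (key x)) + 1 ≤ length (fibre (x ∷ xs) (key x))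
      grow-at with key x Fin.≟ key x
      ... | yes _ = ≤-reflexive (+-comm _ 1)
      ... | no ≢ = contradiction refl ≢

    length≤fibres : ∀ (P : ℕ → Set) → P 0 → ∀ xs → (∀ c → P (length (fibre xs c))) →
                    ∃ λ B → P B × length xs ≤ K * B
    length≤fibres P P0 xs Pl with uniform-bound (length ∘ fibre xs) P P0 Pl
    ... | B , PB , l≤B = B , PB , ≤-trans (length≤sum-fibres xs) (sum-bound l≤B)

  -- Quasigroups up to pointwise equality, and their numbering.

  QG : ℕ → ℕ → Set
  QG n k = ∃ λ (f : Vec (Fin k) n → Fin k) → IsQuasigroup f

  -- Pointwise, and blind to the second components: pairs with the same values count as one
  -- quasigroup whatever their proofs are.
  Distinct : ∀ {n k} → QG n k → QG n k → Set
  Distinct (f , _) (g , _) = ¬ f ≗ g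

  distinct⇒length≤1 : ∀ {n k} {S : List (QG n k)} → AllPairs Distinct S →
                      (∀ {f g} → f ∈ S → g ∈ S → proj₁ f ≗ proj₁ g) → length S ≤ 1
  distinct⇒length≤1 []             eq = z≤n
  distinct⇒length≤1 (_ ∷ [])       eq = s≤s z≤n
  distinct⇒length≤1 ((f≢g ∷ _) ∷ _ ∷ _) eq = contradiction (eq (here refl) (there (here refl))) f≢g

  IsQuasigroup-resp-≗ : ∀ {n k} {f g : Vec (Fin k) n → Fin k} → f ≗ g → IsQuasigroup f → IsQuasigroup g
  IsQuasigroup-resp-≗ f≗g q i x =
    (λ eq → proj₁ (q i x) (trans (f≗g _) (trans eq (sym (f≗g _))))) ,
    λ y → proj₁ (proj₂ (q i x) y) , λ eq → trans (sym (f≗g _)) (proj₂ (proj₂ (q i x) y) eq)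

  layer : ∀ {n k} → QG (suc n) k → Fin k → QG n k
  layer (f , q) a = (λ x → f (a ∷ x)) , λ i x → q (suc i) (a ∷ x)

  module _ (n k : ℕ) where

    private
      isQG? = λ j → isQuasigroup? (decode {n} {k} j)

      map-proj₁-toList : ∀ {A : Set} {P : A → Set} {xs} (pxs : All P xs) → map proj₁ (All.toList pxs) ≡ xs
      map-proj₁-toList []         = refl
      map-proj₁-toList (px ∷ pxs) = cong (_ ∷_) (map-proj₁-toList pxs)

      codes = filter isQG? (allFin (k ^ (k ^ n)))
      isQGs = All.toList (all-filter isQG? (allFin (k ^ (k ^ n))))

      map-codes : map proj₁ isQGs ≡ codes
      map-codes = map-proj₁-toList (all-filter isQG? (allFin (k ^ (k ^ n))))

    quasigroups : List (QG n k)
    quasigroups = map (λ (j , q) → decode j , q) isQGs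

    length-quasigroups : length quasigroups ≡ Q n k
    length-quasigroups = begin
      length quasigroups         ≡⟨ length-map _ isQGs ⟩
      length isQGs               ≡⟨ length-map proj₁ isQGs ⟨
      length (map proj₁ isQGs)   ≡⟨ cong length map-codes ⟩
      Q n k                      ∎
      where open ≡-Reasoning

    quasigroups-distinct : AllPairs Distinct quasigroups
    quasigroups-distinct = AllPairs.map⁺ (AllPairs.map (λ i≢j eq → i≢j (decode-injective {n} {k} _ _ eq))
      (AllPairs.map⁻ (subst (AllPairs _≢_) (sym map-codes) (Unique.filter⁺ isQG? (Unique.allFin⁺ _)))))

    private
      code : QG n k → ∃ λ j → j ∈ codes
      code (f , q) with decode-surjective {n} {k} f
      ... | j , eq = j , ∈-filter⁺ isQG? (∈-allFin j) (IsQuasigroup-resp-≗ (sym ∘ eq) q)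

      decode-code : ∀ f → decode (proj₁ (code f)) ≗ proj₁ f
      decode-code (f , q) = proj₂ (decode-surjective {n} {k} f)

    -- The position of a code of `f` in the filtered list whose length defines `Q n k`. Equal
    -- positions give equal codes, hence pointwise equal functions.
    number : QG n k → Fin (Q n k)
    number f = index (proj₂ (code f))

    number-injective : ∀ f g → number f ≡ number g → proj₁ f ≗ proj₁ g
    number-injective f g eq x = begin
      proj₁ f x                          ≡⟨ decode-code f x ⟨
      decode (proj₁ (code f)) x          ≡⟨ cong (λ j → decode j x) same ⟩
      decode (proj₁ (code g)) x          ≡⟨ decode-code g x ⟩
      proj₁ g x                          ∎
      where
      open ≡-Reasoning
      same : proj₁ (code f) ≡ proj₁ (code g)
      same = trans (lookup-index (proj₂ (code f)))
        (trans (cong (List.lookup codes) eq) (sym (lookup-index (proj₂ (code g)))))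

  -- Unary quasigroups and Lehmer codes of permutations.

  lehmer : ∀ {k} (f : Fin k → Fin k) → Injective _≡_ _≡_ f → Fin (k !)
  lehmer {zero}  f inj = zero
  -- The leading digit is the value at 0. Deleting that value and renumbering the others leaves an
  -- injection on one symbol fewer.
  lehmer {suc k} f inj = combine (f zero) (lehmer (λ i → punchOut (f0≢ i)) rest-inj)
    where
    f0≢ : ∀ i → f zero ≢ f (suc i)
    f0≢ i eq = Fin.0≢1+n (inj eq)
    rest-inj : Injective _≡_ _≡_ (λ i → punchOut (f0≢ i))
    rest-inj eq = Fin.suc-injective (inj (Fin.punchOut-injective (f0≢ _) (f0≢ _) eq))

  lehmer-injective : ∀ {k} (f g : Fin k → Fin k) (fi : Injective _≡_ _≡_ f) (gi : Injective _≡_ _≡_ g) →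
                     lehmer f fi ≡ lehmer g gi → f ≗ g
  lehmer-injective {suc k} f g fi gi eq a with Fin.combine-injective (f zero) _ (g zero) _ eq
  lehmer-injective {suc k} f g fi gi eq zero    | f0≡g0 , _   = f0≡g0
  lehmer-injective {suc k} f g fi gi eq (suc i) | f0≡g0 , eq′ =
    punchOut-injective₂ f0≡g0 _ _ (lehmer-injective _ _ _ _ eq′ i)
    where
    punchOut-injective₂ : ∀ {n} {i j k l : Fin (suc n)} → i ≡ j → (i≢k : i ≢ k) (j≢l : j ≢ l) →
                          punchOut i≢k ≡ punchOut j≢l → k ≡ l
    punchOut-injective₂ refl = Fin.punchOut-injective

  -- A unary quasigroup is a permutation, so its Lehmer code determines it and every fibre of the
  -- code has at most one member.
  Q₁≤k! : ∀ k → Q 1 k ≤ k !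
  Q₁≤k! k with length≤fibres key (_≤ 1) z≤n (quasigroups 1 k) fibre≤1
    where
    perm : QG 1 k → Fin k → Fin k
    perm (f , _) a = f (a ∷ [])
    perm-injective : ∀ f → Injective _≡_ _≡_ (perm f)
    perm-injective (f , q) {x} = proj₁ (q zero (x ∷ []))
    key : QG 1 k → Fin (k !)
    key f = lehmer (perm f) (perm-injective f)
    key-injective : ∀ f g → key f ≡ key g → proj₁ f ≗ proj₁ g
    key-injective f g eq (a ∷ []) = lehmer-injective _ _ (perm-injective f) (perm-injective g) eq a
    fibre≤1 : ∀ c → length (fibre key (quasigroups 1 k) c) ≤ 1
    fibre≤1 c = distinct⇒length≤1 (AllPairs.filter⁺ (λ f → key f Fin.≟ c) (quasigroups-distinct 1 k))
      λ {f} {g} f∈ g∈ → key-injective f g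
        (trans (proj₂ (∈-filter⁻ (λ f → key f Fin.≟ c) {xs = quasigroups 1 k} f∈))
          (sym (proj₂ (∈-filter⁻ (λ f → key f Fin.≟ c) {xs = quasigroups 1 k} g∈))))
  ... | B , B≤1 , len = begin
    Q 1 k                      ≡⟨ length-quasigroups 1 k ⟨
    length (quasigroups 1 k)   ≤⟨ len ⟩
    k ! * B                    ≤⟨ *-monoʳ-≤ (k !) B≤1 ⟩
    k ! * 1                    ≡⟨ *-identityʳ (k !) ⟩
    k !                        ∎
    where open ≤-Reasoning

  -- Powers of a sum.

  ^-distribʳ-* : ∀ d m n → (m * n) ^ d ≡ m ^ d * n ^ d
  ^-distribʳ-* zero    m n = refl
  ^-distribʳ-* (suc d) m n = trans (cong (m * n *_) (^-distribʳ-* d m n)) ([m*n]*[o*p]≡[m*o]*[n*p] m n (m ^ d) (n ^ d))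

  doubled-power : ∀ {q d b u} → q ^ d ≤ 2 ^ b → b + d ≤ u → (q + q) ^ d ≤ 2 ^ u
  doubled-power {q} {d} {b} {u} qd bd = begin
    (q + q) ^ d       ≡⟨ cong (_^ d) (cong (q +_) (+-identityʳ q)) ⟨
    (2 * q) ^ d       ≡⟨ ^-distribʳ-* d 2 q ⟩
    2 ^ d * q ^ d     ≤⟨ *-monoʳ-≤ (2 ^ d) qd ⟩
    2 ^ d * 2 ^ b     ≡⟨ ^-distribˡ-+-* 2 d b ⟨
    2 ^ (d + b)       ≤⟨ ^-monoʳ-≤ 2 (≤-trans (≤-reflexive (+-comm d b)) bd) ⟩
    2 ^ u             ∎
    where open ≤-Reasoning

  -- The sum is at most twice the larger part. Doubling costs a factor `2 ^ d` in the `d`-th power,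
  -- and the gap `d` between the exponents pays for it. With `d = 2 ^ m` this is the accounting for
  -- one split of a family.
  sum-power : ∀ p q d a b {u} → p ^ d ≤ 2 ^ a → q ^ d ≤ 2 ^ b → a + d ≤ u → b + d ≤ u →
              (p + q) ^ d ≤ 2 ^ u
  sum-power p q d a b pd qd ad bd with ≤-total p q
  ... | inj₁ p≤q = ≤-trans (^-monoˡ-≤ d (+-monoˡ-≤ q p≤q)) (doubled-power {d = d} qd bd)
  ... | inj₂ q≤p = ≤-trans (^-monoˡ-≤ d (+-monoʳ-≤ p q≤p)) (doubled-power {d = d} pd ad)

  column-injective : ∀ {m k} ((f , _) : QG (suc m) k) x {a b} → f (a ∷ x) ≡ f (b ∷ x) → a ≡ b
  column-injective (f , q) x {a} = proj₁ (q zero (a ∷ x))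

  line-injective : ∀ {m k} ((f , _) : QG m k) i x {a b} → f (x [ i ]≔ a) ≡ f (x [ i ]≔ b) → a ≡ b
  line-injective (f , q) i x = proj₁ (q i x)

  line-surjective : ∀ {m k} ((f , _) : QG m k) i x v → ∃ λ a → f (x [ i ]≔ a) ≡ v
  line-surjective (f , q) i x v = proj₁ (proj₂ (q i x) v) , proj₂ (proj₂ (q i x) v) refl

  -- Families of quasigroups that share all layers but two.

  module _ {m h : ℕ} where

    private
      Σ^m = Vec (Fin (2 + h)) m

    top next : QG (suc m) (2 + h) → Σ^m → Fin (2 + h)
    top  (f , _) x = f (zero ∷ x)
    next (f , _) x = f (suc zero ∷ x)

    SameBase : QG (suc m) (2 + h) → QG (suc m) (2 + h) → Set
    SameBase (f , _) (g , _) = ∀ b x → f (suc (suc b) ∷ x) ≡ g (suc (suc b) ∷ x)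

    -- The value of `g` occurs somewhere in the column of `f` over `x`. It cannot occur in a shared
    -- layer, since `g` would then have it twice in its own column.
    two-values : ∀ f g → SameBase f g → ∀ a → (∀ b → a ≢ suc (suc b)) →
                 ∀ x → proj₁ g (a ∷ x) ≡ top f x ⊎ proj₁ g (a ∷ x) ≡ next f x
    two-values f g base a a∉base x with line-surjective f zero (a ∷ x) (proj₁ g (a ∷ x))
    ... | zero          , eq = inj₁ (sym eq)
    ... | suc zero      , eq = inj₂ (sym eq)
    ... | suc (suc b)   , eq =
      contradiction (column-injective g x (trans (sym eq) (base b x))) (a∉base b)

    top-swapped : ∀ f g → SameBase f g → ∀ x → top g x ≢ top f x → top g x ≡ next f x
    top-swapped f g base x ≢ with two-values f g base zero (λ _ ()) x
    ... | inj₁ eq = contradiction eq ≢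
    ... | inj₂ eq = eq

    -- In the layer 1 the value already taken by the layer 0 is excluded, which leaves only the
    -- second of the two free values of the column.
    top-determines : ∀ f g → SameBase f g → (∀ x → top f x ≡ top g x) → proj₁ f ≗ proj₁ g
    top-determines f g base eq (zero ∷ x)        = eq x
    top-determines f g base eq (suc (suc b) ∷ x) = base b x
    top-determines f g base eq (suc zero ∷ x) with two-values f g base (suc zero) (λ _ ()) x
    ... | inj₁ e = contradiction (column-injective g x (trans e (eq x))) λ ()
    ... | inj₂ e = sym e

    Coherent : List (QG (suc m) (2 + h)) → Set
    Coherent S = ∀ {f g} → f ∈ S → g ∈ S → SameBase f g

    Agree : List (QG (suc m) (2 + h)) → Σ^m → Set
    Agree S x = All (λ f → All (λ g → top f x ≡ top g x) S) S

    agree? : ∀ S x → Dec (Agree S x)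
    agree? S x = All.all? (λ f → All.all? (λ g → top f x Fin.≟ top g x) S) S

    agree : ∀ {S x f g} → Agree S x → f ∈ S → g ∈ S → top f x ≡ top g x
    agree p f∈ g∈ = All.lookup (All.lookup p f∈) g∈

    constant⇒agree : ∀ {S x v} → (∀ {f} → f ∈ S → top f x ≡ v) → Agree S x
    constant⇒agree const = All.tabulate λ f∈ → All.tabulate λ g∈ → trans (const f∈) (sym (const g∈))

    ¬agree⇒∃≢ : ∀ {S x} → ¬ Agree S x → ∀ v → ∃ λ f → f ∈ S × top f x ≢ v
    ¬agree⇒∃≢ {S} {x} ¬p v =
      find (¬All⇒Any¬ (λ f → top f x Fin.≟ v) S λ const → ¬p (constant⇒agree (All.lookup const)))

    undecided-at : List (QG (suc m) (2 + h)) → Σ^m → ℕ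
    undecided-at S x = if does (agree? S x) then 0 else 1

    undecided-at≤1 : ∀ S x → undecided-at S x ≤ 1
    undecided-at≤1 S x with agree? S x
    ... | yes _ = z≤n
    ... | no  _ = ≤-refl

    undecided-at-mono : ∀ {S T} → (∀ {f} → f ∈ T → f ∈ S) → ∀ x → undecided-at T x ≤ undecided-at S x
    undecided-at-mono {S} {T} T⊆S x with agree? T x | agree? S x
    ... | yes _ | _     = z≤n
    ... | no  _ | no  _ = ≤-refl
    ... | no ¬p | yes p = contradiction (All.tabulate λ f∈ → All.tabulate λ g∈ → agree p (T⊆S f∈) (T⊆S g∈)) ¬p

    undecided-at-<⁺ : ∀ {S T x} → Agree T x → ¬ Agree S x → undecided-at T x < undecided-at S x
    undecided-at-<⁺ {S} {T} {x} p ¬q with agree? T x | agree? S x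
    ... | yes _ | no  _ = ≤-refl
    ... | no ¬p | _     = contradiction p ¬p
    ... | _     | yes q = contradiction q ¬q

    undecided-at-<⁻ : ∀ {S T x} → undecided-at T x < undecided-at S x → Agree T x × ¬ Agree S x
    undecided-at-<⁻ {S} {T} {x} lt with agree? T x | agree? S x
    ... | yes p | no ¬q = p , ¬q
    undecided-at-<⁻ () | yes _ | yes _
    undecided-at-<⁻ () | no _ | yes _
    undecided-at-<⁻ (s≤s ()) | no _ | no _

    undecided : List (QG (suc m) (2 + h)) → ℕ
    undecided S = cubeSum m (undecided-at S)

    -- Let `v` be the value on which `T` is unanimous at `x`, and let `t` in `S` differ from it
    -- there. On the line in direction `i`, `t` takes `v` at some other point `y`. Members of `T`
    -- have used `v` at `x`, so none of them takes it at `y`. That leaves them the single value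
    -- `next t y`, while `t` itself keeps `S` divided at `y`.
    settled-line : ∀ {S T s} → Coherent S → (∀ {f} → f ∈ T → f ∈ S) → s ∈ T →
      ∀ x → Agree T x → ¬ Agree S x → ∀ i →
      ∃ λ b → b ≢ lookup x i × Agree T (x [ i ]≔ b) × ¬ Agree S (x [ i ]≔ b)
    settled-line {S} {T} {s} coh T⊆S s∈T x p ¬q i = b , b≢xᵢ , agreeT , disagreeS
      where
      v = top s x
      t-∃ = ¬agree⇒∃≢ ¬q v
      t = proj₁ t-∃
      t∈S = proj₁ (proj₂ t-∃)
      hit = line-surjective (layer t zero) i x v
      b = proj₁ hit
      y = x [ i ]≔ b
      ty≡v : top t y ≡ v
      ty≡v = proj₂ hit
      b≢xᵢ : b ≢ lookup x i
      b≢xᵢ b≡xᵢ = proj₂ (proj₂ t-∃)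
        (trans (cong (top t) (trans (sym ([]≔-lookup x i)) (cong (x [ i ]≔_) (sym b≡xᵢ)))) ty≡v)
      moved : ∀ {u} → u ∈ T → top u y ≢ v
      moved {u} u∈T uy≡v = b≢xᵢ (line-injective (layer u zero) i x (begin
        top u y                       ≡⟨ uy≡v ⟩
        top s x                       ≡⟨ agree p s∈T u∈T ⟩
        top u x                       ≡⟨ cong (top u) ([]≔-lookup x i) ⟨
        top u (x [ i ]≔ lookup x i)   ∎))
        where open ≡-Reasoning
      agreeT : Agree T y
      -- Only two values are possible at `y`, so avoiding `top t y`, which is `v`, forces the other
      -- one.
      agreeT = constant⇒agree λ {u} u∈T → top-swapped t u (coh t∈S (T⊆S u∈T)) y
        λ uy≡ty → moved u∈T (trans uy≡ty ty≡v)
      disagreeS : ¬ Agree S y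
      disagreeS q = moved s∈T (trans (agree q (T⊆S s∈T) t∈S) ty≡v)

    -- By `settled-line` the newly settled points satisfy the closure condition of `cubeSum-gain`,
    -- so settling one point settles at least `2 ^ m`.
    undecided-drop : ∀ {S T s} → Coherent S → (∀ {f} → f ∈ T → f ∈ S) → s ∈ T →
      ∀ x → Agree T x → ¬ Agree S x → undecided T + 2 ^ m ≤ undecided S
    undecided-drop {S} {T} coh T⊆S s∈T x p ¬q =
      cubeSum-gain m (undecided-at-mono T⊆S) closed x (undecided-at-<⁺ p ¬q)
      where
      closed : ∀ x → undecided-at T x < undecided-at S x → ∀ i →
               ∃ λ b → b ≢ lookup x i × undecided-at T (x [ i ]≔ b) < undecided-at S (x [ i ]≔ b)
      closed x lt i with undecided-at-<⁻ {S} {T} {x} lt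
      ... | p , ¬q with settled-line coh T⊆S s∈T x p ¬q i
      ...   | b , b≢ , p′ , ¬q′ = b , b≢ , undecided-at-<⁺ p′ ¬q′

    -- Each split at a disputed point costs at most a factor 2 in size and removes at least `2 ^ m`
    -- undecided points from either part. Raising the length to the power `2 ^ m` states this
    -- without dividing the exponent. A family with nothing undecided has at most one member, by
    -- `top-determines`.
    coherent-bound : ∀ S → Coherent S → AllPairs Distinct S → length S ^ (2 ^ m) ≤ 2 ^ undecided S
    coherent-bound S = bound S (<-wellFounded (undecided S))
      where
      bound : ∀ S → Acc _<_ (undecided S) → Coherent S → AllPairs Distinct S →
              length S ^ (2 ^ m) ≤ 2 ^ undecided S
      bound S rec coh dist with allVec? (agree? S)
      ... | yes p = begin
        length S ^ (2 ^ m) ≤⟨ ^-monoˡ-≤ (2 ^ m) (distinct⇒length≤1 dist λ {f} {g} f∈ g∈ →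
                                top-determines f g (coh f∈ g∈) λ x → agree (p x) f∈ g∈) ⟩
        1 ^ (2 ^ m)        ≡⟨ ^-zeroˡ (2 ^ m) ⟩
        1                  ≤⟨ m^n>0 2 (undecided S) ⟩
        2 ^ undecided S     ∎
        where open ≤-Reasoning
      bound [] rec coh dist | no ¬p = contradiction (λ _ → []) ¬p
      bound S@(f ∷ _) (acc rec) coh dist | no ¬p with ¬∀⟶∃¬ᵛ m (agree? S) ¬p
      ... | x , ¬q = subst (λ l → l ^ (2 ^ m) ≤ 2 ^ undecided S) (sym (length-split P? S))
          (sum-power (length S₁) (length S₂) (2 ^ m) (undecided S₁) (undecided S₂)
            (recurse P? dropS₁) (recurse (¬? ∘ P?) dropS₂) dropS₁ dropS₂)
        where
        P? = λ g → top g x Fin.≟ top f x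
        S₁ = filter P? S
        S₂ = filter (¬? ∘ P?) S
        -- A member that differs from `f` at `x`. It makes the second part nonempty, as
        -- `undecided-drop` requires; `f` does the same for the first part.
        t-∃ = ¬agree⇒∃≢ {S} ¬q (top f x)
        dropS₁ : undecided S₁ + 2 ^ m ≤ undecided S
        dropS₁ = undecided-drop coh (proj₁ ∘ ∈-filter⁻ P?) (∈-filter⁺ P? {xs = S} (here refl) refl) x
          (constant⇒agree (proj₂ ∘ ∈-filter⁻ P? {xs = S})) ¬q
        dropS₂ : undecided S₂ + 2 ^ m ≤ undecided S
        dropS₂ = undecided-drop coh (proj₁ ∘ ∈-filter⁻ (¬? ∘ P?))
          (∈-filter⁺ (¬? ∘ P?) (proj₁ (proj₂ t-∃)) (proj₂ (proj₂ t-∃))) x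
          -- Whoever does not take the value of `f` at `x` takes the only other one, so the second
          -- part is unanimous at `x` too.
          (constant⇒agree λ {g} g∈ → let (g∈S , ≢) = ∈-filter⁻ (¬? ∘ P?) {xs = S} g∈ in
            top-swapped f g (coh (here refl) g∈S) x ≢) ¬q
        recurse : ∀ {R : QG (suc m) (2 + h) → Set} (R? : ∀ g → Dec (R g)) →
          undecided (filter R? S) + 2 ^ m ≤ undecided S →
          length (filter R? S) ^ (2 ^ m) ≤ 2 ^ undecided (filter R? S)
        recurse R? drop = bound (filter R? S)
          (rec (<-≤-trans (m<m+n _ (m^n>0 2 m)) drop))
          (λ f∈ g∈ → coh (proj₁ (∈-filter⁻ R? f∈)) (proj₁ (∈-filter⁻ R? g∈)))
          (AllPairs.filter⁺ R? dist)

  -- The recursion from arity m to arity m + 1.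

  funToFin-injective : ∀ {m n} (f g : Fin m → Fin n) → funToFin f ≡ funToFin g → f ≗ g
  funToFin-injective {m} {n} f g eq i = begin
    f i                                ≡⟨ Fin.finToFun-funToFin f i ⟨
    finToFun {n} {m} (funToFin f) i    ≡⟨ cong (λ c → finToFun {n} {m} c i) eq ⟩
    finToFun {n} {m} (funToFin g) i    ≡⟨ Fin.finToFun-funToFin g i ⟩
    g i                                ∎
    where open ≡-Reasoning

  -- Group the quasigroups by the numbers of their `h` layers from 2 on. There are `Q m k ^ h` keys,
  -- and each fibre is coherent with at most `k ^ m` undecided points. The power `2 ^ m` on both
  -- sides replaces the fractional exponent of the fibre bound.
  Q-step : ∀ m h → Q (suc m) (2 + h) ^ (2 ^ m) ≤ (Q m (2 + h) ^ h) ^ (2 ^ m) * 2 ^ ((2 + h) ^ m)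
  Q-step m h = begin
    Q (suc m) k ^ d                      ≡⟨ cong (_^ d) (length-quasigroups (suc m) k) ⟨
    length (quasigroups (suc m) k) ^ d   ≤⟨ ^-monoˡ-≤ d (proj₂ (proj₂ bounded)) ⟩
    (Q m k ^ h * B) ^ d                  ≡⟨ ^-distribʳ-* d (Q m k ^ h) B ⟩
    (Q m k ^ h) ^ d * B ^ d              ≤⟨ *-monoʳ-≤ ((Q m k ^ h) ^ d) (proj₁ (proj₂ bounded)) ⟩
    (Q m k ^ h) ^ d * E                  ∎
    where
    open ≤-Reasoning
    k = 2 + h
    d = 2 ^ m
    E = 2 ^ (k ^ m)
    base : QG (suc m) k → Fin h → Fin (Q m k)
    base f b = number m k (layer f (suc (suc b)))
    key : QG (suc m) k → Fin (Q m k ^ h)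
    key f = funToFin (base f)
    key-injective : ∀ f g → key f ≡ key g → SameBase f g
    key-injective f g eq b = number-injective m k (layer f (suc (suc b))) (layer g (suc (suc b)))
      (funToFin-injective (base f) (base g) eq b)
    -- This covers the default bound 0, which `uniform-bound` returns when there are no keys.
    0^d≤E : 0 ^ d ≤ E
    0^d≤E = ≤-trans (^-monoˡ-≤ d (z≤n {1})) (≤-trans (≤-reflexive (^-zeroˡ d)) (m^n>0 2 (k ^ m)))
    fibre-bound : ∀ c → length (fibre key (quasigroups (suc m) k) c) ^ d ≤ E
    fibre-bound c = ≤-trans
      (coherent-bound (fibre key (quasigroups (suc m) k) c)
        (λ {f} {g} f∈ g∈ → key-injective f g (trans (in-fibre f∈) (sym (in-fibre g∈))))
        (AllPairs.filter⁺ (λ f → key f Fin.≟ c) (quasigroups-distinct (suc m) k)))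
      (^-monoʳ-≤ 2 (cubeSum-bound m (undecided-at≤1 (fibre key (quasigroups (suc m) k) c))))
      where
      in-fibre : ∀ {f} → f ∈ fibre key (quasigroups (suc m) k) c → key f ≡ c
      in-fibre = proj₂ ∘ ∈-filter⁻ (λ f → key f Fin.≟ c) {xs = quasigroups (suc m) k}
    bounded : ∃ λ B → B ^ d ≤ E × length (quasigroups (suc m) k) ≤ Q m k ^ h * B
    bounded = length≤fibres key (λ B → B ^ d ≤ E) 0^d≤E (quasigroups (suc m) k) fibre-bound
    B = proj₁ bounded

  -- Solving the recursion, and bounds with rational exponents.

  ^-cancelˡ-≤ : ∀ n .{{_ : NonZero n}} {a b} → a ^ n ≤ b ^ n → a ≤ b
  ^-cancelˡ-≤ n aⁿ≤bⁿ = ≮⇒≥ λ b<a → <⇒≱ (^-monoˡ-< n b<a) aⁿ≤bⁿ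

  ^-comm : ∀ a m n → (a ^ m) ^ n ≡ (a ^ n) ^ m
  ^-comm a m n = trans (^-*-assoc a m n) (trans (cong (a ^_) (*-comm m n)) (sym (^-*-assoc a n m)))

  ^-^-distribʳ-* : ∀ a b e f n → (a ^ e * b ^ f) ^ n ≡ a ^ (e * n) * b ^ (f * n)
  ^-^-distribʳ-* a b e f n = trans (^-distribʳ-* n (a ^ e) (b ^ f)) (cong₂ _*_ (^-*-assoc a e n) (^-*-assoc b f n))

  -- Since d + k = w, the factor 2 ^ (k ^ suc m) on the left makes the geometric series telescope.
  Q-iterated : ∀ m d → let k = 4 + d ; w = 2 * (2 + d) in
    Q (suc m) k ^ (2 ^ m * d) * 2 ^ (k ^ suc m) ≤ (k !) ^ (w ^ m * d) * 2 ^ (k * w ^ m)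
  Q-iterated zero    d = *-monoˡ-≤ (2 ^ ((4 + d) * 1)) (^-monoˡ-≤ (1 * d) (Q₁≤k! (4 + d)))
  Q-iterated (suc m) d = begin
    q′ ^ (2 ^ suc m * d) * 2 ^ (k * K)                      ≡⟨ cong (_* 2 ^ (k * K)) (^-*-assoc q′ (2 ^ suc m) d) ⟨
    (q′ ^ (2 ^ suc m)) ^ d * 2 ^ (k * K)                    ≤⟨ *-monoˡ-≤ (2 ^ (k * K)) (^-monoˡ-≤ d (Q-step (suc m) h)) ⟩
    ((q ^ h) ^ (2 ^ suc m) * 2 ^ K) ^ d * 2 ^ (k * K)       ≡⟨ cong (λ z → (z * 2 ^ K) ^ d * 2 ^ (k * K)) (^-*-assoc q h (2 ^ suc m)) ⟩
    (q ^ (h * 2 ^ suc m) * 2 ^ K) ^ d * 2 ^ (k * K)         ≡⟨ cong (_* 2 ^ (k * K)) (^-^-distribʳ-* q 2 (h * 2 ^ suc m) K d) ⟩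
    q ^ (h * 2 ^ suc m * d) * 2 ^ (K * d) * 2 ^ (k * K)     ≡⟨ *-assoc (q ^ (h * 2 ^ suc m * d)) _ _ ⟩
    q ^ (h * 2 ^ suc m * d) * (2 ^ (K * d) * 2 ^ (k * K))   ≡⟨ cong (q ^ (h * 2 ^ suc m * d) *_) (^-distribˡ-+-* 2 (K * d) (k * K)) ⟨
    q ^ (h * 2 ^ suc m * d) * 2 ^ (K * d + k * K)           ≡⟨ cong₂ (λ x y → q ^ x * 2 ^ y) (exp₁ (2 ^ m) d) (exp₂ K d) ⟩
    q ^ (2 ^ m * d * w) * 2 ^ (K * w)                       ≡⟨ ^-^-distribʳ-* q 2 (2 ^ m * d) K w ⟨
    (q ^ (2 ^ m * d) * 2 ^ K) ^ w                           ≤⟨ ^-monoˡ-≤ w (Q-iterated m d) ⟩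
    ((k !) ^ (w ^ m * d) * 2 ^ (k * w ^ m)) ^ w             ≡⟨ ^-^-distribʳ-* (k !) 2 (w ^ m * d) (k * w ^ m) w ⟩
    (k !) ^ (w ^ m * d * w) * 2 ^ (k * w ^ m * w)           ≡⟨ cong₂ (λ x y → (k !) ^ x * 2 ^ y) (exp₃ (w ^ m) d w) (exp₄ k (w ^ m) w) ⟩
    (k !) ^ (w ^ suc m * d) * 2 ^ (k * w ^ suc m)           ∎
    where
    open ≤-Reasoning
    k = 4 + d
    h = 2 + d
    w = 2 * h
    K = k ^ suc m
    q = Q (suc m) k
    q′ = Q (suc (suc m)) k
    exp₁ : ∀ t d → (2 + d) * (2 * t) * d ≡ t * d * (2 * (2 + d))
    exp₁ = solve-∀
    exp₂ : ∀ K d → K * d + (4 + d) * K ≡ K * (2 * (2 + d))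
    exp₂ = solve-∀
    exp₃ : ∀ x d w → x * d * w ≡ w * x * d
    exp₃ = solve-∀
    exp₄ : ∀ k x w → k * x * w ≡ k * (w * x)
    exp₄ = solve-∀

  -- This says that log₂ Q(n,k) is at most `M` times log₂ k! + k/(k-4), with `M` = (k-2)^(n-1) and n
  -- = `suc m`, multiplied through by `d` = k-4.
  Q-bound : ∀ m d → let k = 4 + d ; M = (2 + d) ^ m in
    Q (suc m) k ^ d ≤ (k !) ^ (M * d) * 2 ^ (k * M)
  Q-bound m d = ^-cancelˡ-≤ t {{m^n≢0 2 m}} (begin
    (q ^ d) ^ t                                     ≡⟨ ^-*-assoc q d t ⟩
    q ^ (d * t)                                     ≡⟨ cong (q ^_) (*-comm d t) ⟩
    -- The factor introduced for telescoping is at least 1, so restoring it only enlarges this side.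
    q ^ (t * d)                                     ≤⟨ m≤m*n _ (2 ^ (k ^ suc m)) {{m^n≢0 2 (k ^ suc m)}} ⟩
    q ^ (t * d) * 2 ^ (k ^ suc m)                   ≤⟨ Q-iterated m d ⟩
    -- Since `w ^ m` is `t * M`, the right side becomes a `t`-th power and the root can be taken.
    (k !) ^ (w ^ m * d) * 2 ^ (k * w ^ m)           ≡⟨ cong (λ x → (k !) ^ (x * d) * 2 ^ (k * x)) (^-distribʳ-* m 2 (2 + d)) ⟩
    (k !) ^ (t * M * d) * 2 ^ (k * (t * M))         ≡⟨ cong₂ (λ x y → (k !) ^ x * 2 ^ y) (exp₁ t M d) (exp₂ k t M) ⟩
    (k !) ^ (M * d * t) * 2 ^ (k * M * t)           ≡⟨ ^-^-distribʳ-* (k !) 2 (M * d) (k * M) t ⟨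
    ((k !) ^ (M * d) * 2 ^ (k * M)) ^ t             ∎)
    where
    open ≤-Reasoning
    k = 4 + d
    w = 2 * (2 + d)
    M = (2 + d) ^ m
    t = 2 ^ m
    q = Q (suc m) k
    exp₁ : ∀ t M d → t * M * d ≡ M * d * t
    exp₁ = solve-∀
    exp₂ : ∀ k t M → k * (t * M) ≡ k * M * t
    exp₂ = solve-∀

  -- Here p₁ / q₁ bounds log₂ F from above and p / q bounds log₂ (a / b) from below.
  power-bound : ∀ {N F} d k M p₁ q₁ p q a b .{{_ : NonZero d}} .{{_ : NonZero q₁}} .{{_ : NonZero q}} →
    N ^ d ≤ F ^ (M * d) * 2 ^ (k * M) → F ^ q₁ ≤ 2 ^ p₁ →
    (p₁ * d + k * q₁) * M * q ≤ p * (q₁ * d) → 2 ^ p * b ^ q ≤ a ^ q → N * b ≤ a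
  power-bound {N} {F} d k M p₁ q₁ p q a b N-bound F-bound exponent a-bound =
    -- The power `q` clears the denominator of `p / q`; the power `q₁ * d` clears those of `p₁ / q₁`
    -- and `k / d`.
    ^-cancelˡ-≤ q (^-cancelˡ-≤ (q₁ * d) {{m*n≢0 q₁ d}} (begin
    ((N * b) ^ q) ^ e                     ≡⟨ cong (_^ e) (^-distribʳ-* q N b) ⟩
    (N ^ q * b ^ q) ^ e                   ≡⟨ ^-distribʳ-* e (N ^ q) (b ^ q) ⟩
    (N ^ q) ^ e * (b ^ q) ^ e             ≤⟨ *-monoˡ-≤ ((b ^ q) ^ e) N-bound′ ⟩
    (2 ^ p) ^ e * (b ^ q) ^ e             ≡⟨ ^-distribʳ-* e (2 ^ p) (b ^ q) ⟨
    (2 ^ p * b ^ q) ^ e                   ≤⟨ ^-monoˡ-≤ e a-bound ⟩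
    (a ^ q) ^ e                           ∎))
    where
    open ≤-Reasoning
    e = q₁ * d
    exp₁ : ∀ d k M p₁ q₁ → p₁ * (M * d) + k * M * q₁ ≡ (p₁ * d + k * q₁) * M
    exp₁ = solve-∀
    N-bound′ : (N ^ q) ^ e ≤ (2 ^ p) ^ e
    N-bound′ = begin
      (N ^ q) ^ e                                     ≡⟨ ^-comm N q e ⟩
      (N ^ e) ^ q                                     ≡⟨ cong (λ x → (N ^ x) ^ q) (*-comm q₁ d) ⟩
      (N ^ (d * q₁)) ^ q                              ≡⟨ cong (_^ q) (^-*-assoc N d q₁) ⟨
      ((N ^ d) ^ q₁) ^ q                              ≤⟨ ^-monoˡ-≤ q (^-monoˡ-≤ q₁ N-bound) ⟩
      ((F ^ (M * d) * 2 ^ (k * M)) ^ q₁) ^ q          ≡⟨ cong (_^ q) (^-distribʳ-* q₁ (F ^ (M * d)) _) ⟩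
      ((F ^ (M * d)) ^ q₁ * (2 ^ (k * M)) ^ q₁) ^ q   ≡⟨ cong (_^ q) (cong₂ _*_ (^-comm F (M * d) q₁) (^-*-assoc 2 (k * M) q₁)) ⟩
      ((F ^ q₁) ^ (M * d) * 2 ^ (k * M * q₁)) ^ q     ≤⟨ ^-monoˡ-≤ q (*-monoˡ-≤ _ (^-monoˡ-≤ (M * d) F-bound)) ⟩
      ((2 ^ p₁) ^ (M * d) * 2 ^ (k * M * q₁)) ^ q     ≡⟨ cong (λ x → (x * 2 ^ (k * M * q₁)) ^ q) (^-*-assoc 2 p₁ (M * d)) ⟩
      (2 ^ (p₁ * (M * d)) * 2 ^ (k * M * q₁)) ^ q     ≡⟨ cong (_^ q) (^-distribˡ-+-* 2 (p₁ * (M * d)) _) ⟨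
      (2 ^ (p₁ * (M * d) + k * M * q₁)) ^ q           ≡⟨ ^-*-assoc 2 (p₁ * (M * d) + k * M * q₁) q ⟩
      2 ^ ((p₁ * (M * d) + k * M * q₁) * q)           ≡⟨ cong (λ x → 2 ^ (x * q)) (exp₁ d k M p₁ q₁) ⟩
      2 ^ ((p₁ * d + k * q₁) * M * q)                 ≤⟨ ^-monoʳ-≤ 2 exponent ⟩
      2 ^ (p * e)                                     ≡⟨ ^-*-assoc 2 p e ⟨
      (2 ^ p) ^ e                                     ∎

open import Data.Integer using (+_; -[1+_])
import Data.Integer as ℤ
import Data.Integer.Properties as ℤ
open import Data.Nat using (ℕ; zero; suc; s≤s; _∸_; _!) renaming (_≤_ to _≤ℕ_; _^_ to _^ℕ_)
import Data.Nat as ℕ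
import Data.Nat.Properties as ℕ
open import Data.Nat.Tactic.RingSolver using (solve-∀)
open import Data.Product using (∃₂; _,_; proj₂)
open import Data.Rational.Unnormalised using (mkℚᵘ; _/_; 0ℚᵘ; *≤*)
import Data.Rational.Unnormalised as ℚ
import Data.Rational.Unnormalised.Properties as ℚ
open import Defs
open import Relation.Binary.PropositionalEquality using (_≡_; refl; sym; trans; cong; cong₂; subst; subst₂; module ≡-Reasoning)
open Counting using (Q-bound; power-bound)

-- Unnormalised fractions with natural numerators.

nonNeg-fraction : ∀ {s} → 0ℚᵘ ℚ.≤ s → ∃₂ λ p q → s ≡ mkℚᵘ (+ p) q
nonNeg-fraction {mkℚᵘ (+ p)    q} _        = p , q , refl
nonNeg-fraction {mkℚᵘ -[1+ _ ] _} (*≤* ())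

-- Propositional equality, not `≃`: unnormalised arithmetic never cancels, so numerator and
-- denominator can be matched separately. The same holds for `/-+` and `/-^`.
/-* : ∀ a b p q .{{_ : ℕ.NonZero b}} .{{_ : ℕ.NonZero q}} .{{_ : ℕ.NonZero (b ℕ.* q)}} →
      (+ a / b) ℚ.* (+ p / q) ≡ + (a ℕ.* p) / (b ℕ.* q)
/-* a (suc b) p (suc q) = cong (_/ (suc b ℕ.* suc q)) (sym (ℤ.pos-* a p))

/-+ : ∀ a b p q .{{_ : ℕ.NonZero b}} .{{_ : ℕ.NonZero q}} .{{_ : ℕ.NonZero (b ℕ.* q)}} →
      (+ a / b) ℚ.+ (+ p / q) ≡ + (a ℕ.* q ℕ.+ p ℕ.* b) / (b ℕ.* q)
/-+ a (suc b) p (suc q) = cong (_/ (suc b ℕ.* suc q))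
  (cong₂ ℤ._+_ (sym (ℤ.pos-* a (suc q))) (sym (ℤ.pos-* p (suc b))))

/-^ : ∀ a b n .{{_ : ℕ.NonZero b}} .{{_ : ℕ.NonZero (b ^ℕ n)}} → (+ a / b) ^ n ≡ + (a ^ℕ n) / (b ^ℕ n)
/-^ a b zero    = refl
/-^ a b (suc n) = trans (cong ((+ a / b) ℚ.*_) (/-^ a b n)) (/-* a b (a ^ℕ n) (b ^ℕ n))
  where
  instance
    bⁿ≢0 : ℕ.NonZero (b ^ℕ n)
    bⁿ≢0 = ℕ.m^n≢0 b n

/-≤⁻ : ∀ a b p q .{{_ : ℕ.NonZero b}} .{{_ : ℕ.NonZero q}} →
       + a / b ℚ.≤ + p / q → a ℕ.* q ≤ℕ p ℕ.* b
/-≤⁻ a (suc b) p (suc q) (*≤* le) =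
  ℤ.drop‿+≤+ (subst₂ ℤ._≤_ (sym (ℤ.pos-* a (suc q))) (sym (ℤ.pos-* p (suc b))) le)

/-≤⁺ : ∀ a b p q .{{_ : ℕ.NonZero b}} .{{_ : ℕ.NonZero q}} →
       a ℕ.* q ≤ℕ p ℕ.* b → + a / b ℚ.≤ + p / q
/-≤⁺ a (suc b) p (suc q) le =
  *≤* (subst₂ ℤ._≤_ (ℤ.pos-* a (suc q)) (ℤ.pos-* p (suc b)) (ℤ.+≤+ le))

ratℕ-^ : ∀ a n → ratℕ a ^ n ≡ ratℕ (a ^ℕ n)
ratℕ-^ a zero    = refl
ratℕ-^ a (suc n) = trans (cong (ratℕ a ℚ.*_) (ratℕ-^ a n)) (/-* a 1 (a ^ℕ n) 1)

≤2^⇒ : ∀ {a p q} → a ≤2^ mkℚᵘ (+ p) q → a ^ℕ suc q ≤ℕ 2 ^ℕ p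
≤2^⇒ {a} {p} {q} le = subst₂ _≤ℕ_ (ℕ.*-identityʳ _) (ℕ.*-identityʳ _)
  (/-≤⁻ (a ^ℕ suc q) 1 (2 ^ℕ p) 1 (subst₂ ℚ._≤_ (ratℕ-^ a (suc q)) (ratℕ-^ 2 p) le))

2^≤ℚ⇒ : ∀ {p q a b} → 2^ mkℚᵘ (+ p) q ≤ℚ mkℚᵘ (+ a) b → 2 ^ℕ p ℕ.* suc b ^ℕ suc q ≤ℕ a ^ℕ suc q
2^≤ℚ⇒ {p} {q} {a} {b} (_ , le) = subst (2 ^ℕ p ℕ.* suc b ^ℕ suc q ≤ℕ_) (ℕ.*-identityʳ _)
  (/-≤⁻ (2 ^ℕ p) 1 (a ^ℕ suc q) (suc b ^ℕ suc q)
    (subst₂ ℚ._≤_ (ratℕ-^ 2 p) (/-^ a (suc b) (suc q)) le))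
  where
  instance
    bⁿ≢0 : ℕ.NonZero (suc b ^ℕ suc q)
    bⁿ≢0 = ℕ.m^n≢0 (suc b) (suc q)

-- The exponent c_k (k-2)^n as a fraction, and the bound on Q.

exponent-fraction : ∀ p₁ q₁ h d k M .{{_ : ℕ.NonZero q₁}} .{{_ : ℕ.NonZero h}} .{{_ : ℕ.NonZero d}}
  .{{_ : ℕ.NonZero (q₁ ℕ.* h)}} .{{_ : ℕ.NonZero (1 ℕ.* d)}} .{{_ : ℕ.NonZero (q₁ ℕ.* h ℕ.* (1 ℕ.* d))}}
  .{{_ : ℕ.NonZero (q₁ ℕ.* h ℕ.* (1 ℕ.* d) ℕ.* 1)}} →
  ((+ p₁ / q₁) ℚ.* (+ 1 / h) ℚ.+ ratℕ k ℚ.* (+ 1 / d)) ℚ.* ratℕ M ≡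
  + ((p₁ ℕ.* 1 ℕ.* (1 ℕ.* d) ℕ.+ k ℕ.* 1 ℕ.* (q₁ ℕ.* h)) ℕ.* M) / (q₁ ℕ.* h ℕ.* (1 ℕ.* d) ℕ.* 1)
exponent-fraction p₁ q₁ h d k M = begin
  -- The factors 1 that these operations leave behind are kept; `exponent-bound` removes them in
  -- natural numbers.
  ((+ p₁ / q₁) ℚ.* (+ 1 / h) ℚ.+ ratℕ k ℚ.* (+ 1 / d)) ℚ.* ratℕ M
    ≡⟨ cong (ℚ._* ratℕ M) (cong₂ ℚ._+_ (/-* p₁ q₁ 1 h) (/-* k 1 1 d)) ⟩
  ((+ (p₁ ℕ.* 1) / (q₁ ℕ.* h)) ℚ.+ (+ (k ℕ.* 1) / (1 ℕ.* d))) ℚ.* ratℕ M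
    ≡⟨ cong (ℚ._* ratℕ M) (/-+ (p₁ ℕ.* 1) (q₁ ℕ.* h) (k ℕ.* 1) (1 ℕ.* d)) ⟩
  (+ (p₁ ℕ.* 1 ℕ.* (1 ℕ.* d) ℕ.+ k ℕ.* 1 ℕ.* (q₁ ℕ.* h)) / (q₁ ℕ.* h ℕ.* (1 ℕ.* d))) ℚ.* ratℕ M
    ≡⟨ /-* _ (q₁ ℕ.* h ℕ.* (1 ℕ.* d)) M 1 ⟩
  _ ∎
  where open ≡-Reasoning

exponent-bound : ∀ p₁ q₁ p q h d k M .{{_ : ℕ.NonZero q₁}} .{{_ : ℕ.NonZero q}} .{{_ : ℕ.NonZero h}} .{{_ : ℕ.NonZero d}} →
  ((+ p₁ / q₁) ℚ.* (+ 1 / h) ℚ.+ ratℕ k ℚ.* (+ 1 / d)) ℚ.* ratℕ (h ℕ.* M) ℚ.≤ + p / q →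
  (p₁ ℕ.* d ℕ.+ k ℕ.* q₁) ℕ.* M ℕ.* q ≤ℕ p ℕ.* (q₁ ℕ.* d)
exponent-bound p₁ q₁ p q h d k M le = ℕ.*-cancelˡ-≤ h (begin
  h ℕ.* ((p₁ ℕ.* d ℕ.+ k ℕ.* q₁) ℕ.* M ℕ.* q)
    -- The stated exponent multiplies `k / d` by `h * M`, whereas `Q-bound` has only `M` there. This
    -- spare factor `h` is given away here; on the logarithm the `h` cancels exactly against the
    -- division by k-2.
    ≤⟨ ℕ.*-monoʳ-≤ h (ℕ.*-monoˡ-≤ q (ℕ.*-monoˡ-≤ M (ℕ.+-monoʳ-≤ (p₁ ℕ.* d) (ℕ.m≤m*n (k ℕ.* q₁) h)))) ⟩
  h ℕ.* ((p₁ ℕ.* d ℕ.+ k ℕ.* q₁ ℕ.* h) ℕ.* M ℕ.* q)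
    ≡⟨ lhs p₁ q₁ q h d k M ⟩
  (p₁ ℕ.* 1 ℕ.* (1 ℕ.* d) ℕ.+ k ℕ.* 1 ℕ.* (q₁ ℕ.* h)) ℕ.* (h ℕ.* M) ℕ.* q
    ≤⟨ /-≤⁻ _ (q₁ ℕ.* h ℕ.* (1 ℕ.* d) ℕ.* 1) p q (subst (ℚ._≤ + p / q) (exponent-fraction p₁ q₁ h d k (h ℕ.* M)) le) ⟩
  p ℕ.* (q₁ ℕ.* h ℕ.* (1 ℕ.* d) ℕ.* 1)
    ≡⟨ rhs p q₁ h d ⟩
  h ℕ.* (p ℕ.* (q₁ ℕ.* d)) ∎)
  where
  open ℕ.≤-Reasoning
  instance
    q₁h≢0 : ℕ.NonZero (q₁ ℕ.* h)
    q₁h≢0 = ℕ.m*n≢0 q₁ h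
    1d≢0 : ℕ.NonZero (1 ℕ.* d)
    1d≢0 = ℕ.m*n≢0 1 d
    q₁hd≢0 : ℕ.NonZero (q₁ ℕ.* h ℕ.* (1 ℕ.* d))
    q₁hd≢0 = ℕ.m*n≢0 (q₁ ℕ.* h) (1 ℕ.* d)
    q₁hd1≢0 : ℕ.NonZero (q₁ ℕ.* h ℕ.* (1 ℕ.* d) ℕ.* 1)
    q₁hd1≢0 = ℕ.m*n≢0 (q₁ ℕ.* h ℕ.* (1 ℕ.* d)) 1
  lhs : ∀ p₁ q₁ q h d k M → h ℕ.* ((p₁ ℕ.* d ℕ.+ k ℕ.* q₁ ℕ.* h) ℕ.* M ℕ.* q) ≡
        (p₁ ℕ.* 1 ℕ.* (1 ℕ.* d) ℕ.+ k ℕ.* 1 ℕ.* (q₁ ℕ.* h)) ℕ.* (h ℕ.* M) ℕ.* q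
  lhs = solve-∀
  rhs : ∀ p q₁ h d → p ℕ.* (q₁ ℕ.* h ℕ.* (1 ℕ.* d) ℕ.* 1) ≡ h ℕ.* (p ℕ.* (q₁ ℕ.* d))
  rhs = solve-∀

-- Nonnegativity allows `l`, `s` and `g` to be read as fractions of naturals, after which the claim
-- is `power-bound`.
2^-bound : ∀ {N F l s g} h d k M .{{_ : ℕ.NonZero h}} .{{_ : ℕ.NonZero d}} →
  N ^ℕ d ≤ℕ F ^ℕ (M ℕ.* d) ℕ.* 2 ^ℕ (k ℕ.* M) →
  0ℚᵘ ℚ.≤ l → 0ℚᵘ ℚ.≤ s → 0ℚᵘ ℚ.≤ g → F ≤2^ l →
  (l ℚ.* (+ 1 / h) ℚ.+ ratℕ k ℚ.* (+ 1 / d)) ℚ.* ratℕ (h ℕ.* M) ℚ.≤ s →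
  2^ s ≤ℚ g → ratℕ N ℚ.≤ g
2^-bound {N} {F} h d k M N-bound 0≤l 0≤s 0≤g F≤2^l exponent≤s 2^s≤g
  with nonNeg-fraction 0≤l | nonNeg-fraction 0≤s | nonNeg-fraction 0≤g
... | p₁ , q₁ , refl | p , q , refl | a , b , refl =
  /-≤⁺ N 1 a (suc b) (ℕ.≤-trans
    (power-bound d k M p₁ (suc q₁) p (suc q) a (suc b) N-bound (≤2^⇒ {F} {p₁} {q₁} F≤2^l)
      (exponent-bound p₁ (suc q₁) p (suc q) h d k M exponent≤s) (2^≤ℚ⇒ {p} {q} {a} {b} 2^s≤g))
    (ℕ.≤-reflexive (sym (ℕ.*-identityʳ a))))

theorem1 : (k n : ℕ) (5≤k : 5 ≤ℕ k) → 2 ≤ℕ n →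
    fromℕ (Q n k) ≤ 2^ (c k 5≤k * (k ∸ 2) ^ℕ n)
-- A rational `r` above the right side unfolds, cut by cut, into rational witnesses: `g` below `r`
-- bounds 2 to the power `s`, `s` lies above `t` times (k-2)^n, `t` lies above `t₁ + t₂`, and these
-- lie above the two summands of the constant. Innermost is `l`, an upper bound for log₂ k!.
theorem1 k@(suc (suc (suc (suc (suc j))))) (suc m) (s≤s (s≤s (s≤s (s≤s (s≤s _))))) _ r
  (g , (s , (_ , (t , (_ , (t₁ , t₂ ,
    (_ , (s₁ , (l , k!≤2^l , l<s₁) , refl) , s₁/h<t₁) ,
    (_ , (s₂ , (_ , refl , k<s₂) , refl) , s₂/d<t₂) , refl) , t₁+t₂<t) , refl) , tM<s) , g>0 , 2^s≤g) , g<r) =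
  ratℕ (Q (suc m) k) , refl ,
  ℚ.≤-<-trans (2^-bound h d k (h ^ℕ m) (Q-bound m d) 0≤l 0≤s (ℚ.<⇒≤ (ℚ.positive⁻¹ g {{g>0}}))
                 k!≤2^l exponent≤s (g>0 , 2^s≤g)) g<r
  where
  h = 3 ℕ.+ j
  d = 1 ℕ.+ j
  X = l ℚ.* (+ 1 / h) ℚ.+ ratℕ k ℚ.* (+ 1 / d)
  0≤l : 0ℚᵘ ℚ.≤ l
  -- The bound stored in the cut `log₂` is 0, so a witness `l` below 0 would put 0 into the cut.
  0≤l = ℚ.≮⇒≥ λ l<0 → proj₂ (bounded (log₂ (k !) {{k ℕ.!≢0}})) (l , k!≤2^l , l<0)
  -- `X` is the constant c_k with log₂ k! replaced by `l`; the witnesses chain up from it to `t`.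
  X≤t : X ℚ.≤ t
  X≤t = ℚ.≤-trans (ℚ.+-mono-≤
    (ℚ.≤-trans (ℚ.*-monoˡ-≤-nonNeg (+ 1 / h) (ℚ.<⇒≤ l<s₁)) (ℚ.<⇒≤ s₁/h<t₁))
    (ℚ.≤-trans (ℚ.*-monoˡ-≤-nonNeg (+ 1 / d) (ℚ.<⇒≤ k<s₂)) (ℚ.<⇒≤ s₂/d<t₂)))
    (ℚ.<⇒≤ t₁+t₂<t)
  exponent≤s : X ℚ.* ratℕ (h ^ℕ suc m) ℚ.≤ s
  exponent≤s = ℚ.≤-trans (ℚ.*-monoˡ-≤-nonNeg (ratℕ (h ^ℕ suc m)) X≤t) (ℚ.<⇒≤ tM<s)
  0≤X : 0ℚᵘ ℚ.≤ X
  0≤X = ℚ.+-mono-≤ {0ℚᵘ} {_} {0ℚᵘ}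
    (ℚ.*-mono-≤-nonNeg {0ℚᵘ} {_} {0ℚᵘ} 0≤l (ℚ.nonNegative⁻¹ (+ 1 / h)))
    (ℚ.nonNegative⁻¹ (ratℕ k ℚ.* (+ 1 / d)))
  0≤s : 0ℚᵘ ℚ.≤ s
  0≤s = ℚ.≤-trans (ℚ.*-mono-≤-nonNeg {0ℚᵘ} {_} {0ℚᵘ} 0≤X (ℚ.nonNegative⁻¹ (ratℕ (h ^ℕ suc m)))) exponent≤s
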